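{- Let $n\ge 4$ and let $x$ be any vertex of the path $P_n$. Then there exists a $(P_n,x)$-well path 2-placement.
   Context: $P_n$ is the path on $n$ vertices; $dist$ is distance in $P_n$, $d(y)$ the degree of $y$ in $P_n$, $N(x)$ the set of neighbors of $x$. A permutation $\sigma$ of $V(P_n)$ is a 2-placement of $P_n$ if for every edge $ab$ of $P_n$, $\sigma(a)\sigma(b)$ is not an edge of $P_n$. $P_n^k$ is the $k$-th power of $P_n$; $\sigma(P_n)\subseteq P_n^k$ means $dist(\sigma(a),\sigma(b))\le k$ for every edge $ab$ of $P_n$. A fixed-point-free permutation $\sigma$ of $V(P_n)$ is a $(P_n,x)$-well path 2-placement if: (1) $\sigma$ is a 2-placement of $P_n$; (2) $\sigma(P_n)\subseteq P_n^6$; (3) $dist(x,\sigma(x))\le 2$; (4) $dist(y,\sigma(y))\le 3$ for every $y\in N(x)$ and for every $y$ with $d(y)=1$; (5) every cycle of $\sigma$ (in its disjoint cycle decomposition) has length at most $5$. -}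

module Defs where

open import Data.Fin.Base using (Fin; toℕ)
open import Data.Fin.Permutation using (Permutation′; _⟨$⟩ʳ_)
open import Data.Fin.Subset using (Subset; _∈_; ∣_∣)
open import Data.List.Base using (List; []; _∷_; _∷ʳ_; map; length)
open import Data.List.Relation.Unary.Unique.Propositional using (Unique)
open import Data.Nat.Base using (ℕ; suc; _≤_)
open import Data.Nat.Properties using (_≟_; 1+n≢n)
open import Data.Empty using (⊥)
open import Data.Product.Base using (∃-syntax; _×_)
open import Data.Sum.Base using (_⊎_; swap; [_,_])
open import Data.Vec.Base using (tabulate)
open import Relation.Binary.Construct.Closure.ReflexiveTransitive using (Star; fold)
open import Relation.Binary.Definitions using (Decidable; Symmetric)
open import Relation.Binary.PropositionalEquality.Core using (_≡_; _≢_)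
open import Relation.Nullary using (¬_; does)
open import Relation.Nullary.Decidable using (_⊎-dec_)

record Graph (n : ℕ) : Set₁ where
  field
    Adj        : Fin n → Fin n → Set
    adj?       : Decidable Adj
    adj-sym    : Symmetric Adj
    adj-irrefl : ∀ x → ¬ Adj x x

P : (n : ℕ) → Graph n
P n = record
  { Adj        = λ i j → suc (toℕ i) ≡ toℕ j ⊎ suc (toℕ j) ≡ toℕ i
  ; adj?       = λ i j → (suc (toℕ i) ≟ toℕ j) ⊎-dec (suc (toℕ j) ≟ toℕ i)
  ; adj-sym    = swap
  ; adj-irrefl = λ _ → [ 1+n≢n , 1+n≢n ]
  }

module _ {n : ℕ} (G : Graph n) where
  open Graph G

  N : Fin n → Subset n
  N x = tabulate (λ y → does (adj? x y))

  degree : Fin n → ℕ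
  degree x = ∣ N x ∣

  Walk : Fin n → Fin n → Set
  Walk = Star Adj

  walkLength : ∀ {x y} → Walk x y → ℕ
  walkLength = fold (λ _ _ → ℕ) (λ _ → suc) 0

  -- The distance is a relation, since it is undefined (infinite) between
  -- vertices of different components.
  IsDist : Fin n → Fin n → ℕ → Set
  IsDist x y d = (∃[ w ] walkLength {x} {y} w ≡ d) × (∀ (w : Walk x y) → d ≤ walkLength w)

  Dist≤ : Fin n → Fin n → ℕ → Set
  Dist≤ x y k = ∃[ d ] IsDist x y d × d ≤ k

  Is2Placement : Permutation′ n → Set
  Is2Placement σ = ∀ a b → Adj a b → ¬ Adj (σ ⟨$⟩ʳ a) (σ ⟨$⟩ʳ b)

  -- σ(G) ⊆ Gᵏ
  ImageInPower : Permutation′ n → ℕ → Set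
  ImageInPower σ k = ∀ a b → Adj a b → Dist≤ (σ ⟨$⟩ʳ a) (σ ⟨$⟩ʳ b) k

-- Cycle notation: (x₀ x₁ … xₘ) lists distinct elements with σ xᵢ = xᵢ₊₁ and
-- σ xₘ = x₀.  A cycle of length ℓ is represented by each of its ℓ rotations.
IsCycle : ∀ {n} → Permutation′ n → List (Fin n) → Set
IsCycle σ []       = ⊥
IsCycle σ (x ∷ xs) = Unique (x ∷ xs) × map (σ ⟨$⟩ʳ_) (x ∷ xs) ≡ xs ∷ʳ x

record IsWellPath2Placement (n : ℕ) (x : Fin n) (σ : Permutation′ n) : Set where
  field
    fixedPointFree : ∀ y → σ ⟨$⟩ʳ y ≢ y
    placement      : Is2Placement (P n) σ
    inSixthPower   : ImageInPower (P n) σ 6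
    distRoot       : Dist≤ (P n) x (σ ⟨$⟩ʳ x) 2
    distNeighbour  : ∀ y → y ∈ N (P n) x → Dist≤ (P n) y (σ ⟨$⟩ʳ y) 3
    distLeaf       : ∀ y → degree (P n) y ≡ 1 → Dist≤ (P n) y (σ ⟨$⟩ʳ y) 3
    cycleLength    : ∀ c → IsCycle σ c → length c ≤ 5

{-# OPTIONS --safe #-}
-- Tabulated permutations of four to seven vertices, together with their
-- inverses, settle the paths of those orders.  They move every vertex by at
-- most 3, and every vertex is moved by at most 2 by one of the two.  Longer
-- paths are reduced by splitting off the first four vertices, permuted by
-- (0 1 3 2): vertex 3 goes to 2 and vertex 4 to one of 4, …, 7, so the images
-- of these two neighbours are at distance between 2 and 6 as well.
module Submission where

open import Defs
open import Data.Nat.Base using (ℕ; zero; suc; _+_; _∸_; _≤_; _<_; z≤n; s≤s; s<s; ∣_-_∣)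
open import Data.Nat.Properties using (_≤?_; ≮⇒≥; ≤-reflexive; ≤-trans; +-monoʳ-≤; m≤m+n; ∣-∣-comm; ∣-∣-triangle; ∣n-n∣≡0; module ≤-Reasoning) renaming (_≟_ to _≟ⁿ_)
open import Data.Nat.GeneralisedArithmetic using (iterate)
open import Data.Fin.Base using (Fin; suc; toℕ; _↑ʳ_)
open import Data.Fin.Patterns
open import Data.Fin.Permutation using (Permutation′; permutation; flip; _⟨$⟩ʳ_; _⟨$⟩ˡ_; inverseˡ; inverseʳ)
open import Data.Fin.Properties using (_≟_; all?; any?; ↑ʳ-injective; toℕ≤pred[n])
open import Data.List.Base using (_∷_; _∷ʳ_; map; length)
open import Data.List.Membership.Propositional using (_∈_)
open import Data.List.Properties using (∷-injective)
open import Data.List.Relation.Unary.All using (lookup)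
open import Data.List.Relation.Unary.AllPairs using (_∷_)
open import Data.List.Relation.Unary.Any using (here; there)
open import Data.Product.Base using (∃-syntax; _×_; _,_; proj₁; proj₂)
open import Data.Sum.Base using (inj₁; inj₂) renaming (map to ⊎-map)
open import Data.Vec.Base using (Vec; []; _∷_) renaming (lookup to _‼_)
open import Function.Base using (_∘_)
open import Relation.Binary.Construct.Closure.ReflexiveTransitive using (ε; _◅_; _◅◅_; gmap)
open import Relation.Binary.PropositionalEquality using (_≡_; _≢_; refl; sym; trans; cong; subst)
open import Relation.Nullary using (Dec)
open import Relation.Nullary.Decidable using (True; toWitness; ¬?; _×-dec_; _⊎-dec_; _→-dec_)

private
  variable
    n : ℕ

gap : Fin n → Fin n → ℕ
gap x y = ∣ toℕ x - toℕ y ∣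

∣n-1+n∣≡1 : ∀ n → ∣ n - suc n ∣ ≡ 1
∣n-1+n∣≡1 zero    = refl
∣n-1+n∣≡1 (suc n) = ∣n-1+n∣≡1 n

gap-adjacent : ∀ (x y : Fin n) → Graph.Adj (P n) x y → gap x y ≡ 1
gap-adjacent x y (inj₁ eq) rewrite sym eq = ∣n-1+n∣≡1 (toℕ x)
gap-adjacent x y (inj₂ eq) rewrite sym eq = trans (∣-∣-comm (suc (toℕ y)) (toℕ y)) (∣n-1+n∣≡1 (toℕ y))

gap≤walkLength : ∀ {x y : Fin n} (w : Walk (P n) x y) → gap x y ≤ walkLength (P n) w
gap≤walkLength {x = x} ε = ≤-reflexive (∣n-n∣≡0 (toℕ x))
gap≤walkLength {n} {x} {y} (_◅_ {j = z} e w) = begin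
  gap x y                     ≤⟨ ∣-∣-triangle (toℕ x) (toℕ z) (toℕ y) ⟩
  gap x z + gap z y           ≡⟨ cong (_+ gap z y) (gap-adjacent x z e) ⟩
  suc (gap z y)               ≤⟨ s≤s (gap≤walkLength w) ⟩
  suc (walkLength (P n) w)    ∎
  where open ≤-Reasoning

suc-adjacent : ∀ {x y : Fin n} → Graph.Adj (P n) x y → Graph.Adj (P (suc n)) (suc x) (suc y)
suc-adjacent = ⊎-map (cong suc) (cong suc)

walkLength-gmap-suc : ∀ {x y : Fin n} (w : Walk (P n) x y) →
                      walkLength (P (suc n)) (gmap suc suc-adjacent w) ≡ walkLength (P n) w
walkLength-gmap-suc ε       = refl
walkLength-gmap-suc (e ◅ w) = cong suc (walkLength-gmap-suc w)

walkLength-∷ʳ : ∀ (G : Graph n) {x y z} (w : Walk G x y) (e : Graph.Adj G y z) →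
                walkLength G (w ◅◅ e ◅ ε) ≡ suc (walkLength G w)
walkLength-∷ʳ G ε       e = refl
walkLength-∷ʳ G (_ ◅ w) e = cong suc (walkLength-∷ʳ G w e)

geodesic : ∀ (x y : Fin n) → ∃[ w ] walkLength (P n) {x} {y} w ≡ gap x y
geodesic 0F 0F = ε , refl
-- Matching `suc _` gives the shorter path a first vertex. The walk from it to `y`, shifted by one,
-- starts at the neighbour of `0F`.
geodesic 0F (suc {suc _} y) with w , eq ← geodesic 0F y =
  inj₁ refl ◅ gmap suc suc-adjacent w , cong suc (trans (walkLength-gmap-suc w) eq)
geodesic (suc {suc _} x) 0F with w , eq ← geodesic x 0F =
  gmap suc suc-adjacent w ◅◅ inj₂ refl ◅ ε ,
  trans (walkLength-∷ʳ (P _) (gmap suc suc-adjacent w) (inj₂ refl))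
        -- `∣ toℕ x - 0 ∣` is stuck on the variable `x`; commuted, it computes to `toℕ x`.
        (cong suc (trans (walkLength-gmap-suc w) (trans eq (∣-∣-comm (toℕ x) 0))))
geodesic (suc x) (suc y) with w , eq ← geodesic x y =
  gmap suc suc-adjacent w , trans (walkLength-gmap-suc w) eq

gap⇒Dist≤ : ∀ (x y : Fin n) {k} → gap x y ≤ k → Dist≤ (P n) x y k
gap⇒Dist≤ x y gap≤k = gap x y , (geodesic x y , gap≤walkLength) , gap≤k

-- The head of the equation makes `f y` the next entry, and its tail is the same equation started
-- from `f y`. The closing entry `z` is kept apart from `y` because the start moves while the end
-- stays.
iterate∈cycle : ∀ {A : Set} (f : A → A) {z} y ys k → map f (y ∷ ys) ≡ ys ∷ʳ z →
                k < length ys → iterate f y (suc k) ∈ ys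
iterate∈cycle f y (y′ ∷ ys) 0 eq _ = here (proj₁ (∷-injective eq))
iterate∈cycle f y (y′ ∷ ys) (suc k) eq (s<s k<) with refl , eq′ ← ∷-injective eq =
  there (iterate∈cycle f (f y) ys k eq′ k<)

-- In a longer cycle the iterate that returns to `x` would be an entry of `xs`, against
-- distinctness. So any return time, minimal or not, bounds the length.
cycle-length≤ : ∀ (σ : Permutation′ n) {x xs} k → iterate (σ ⟨$⟩ʳ_) x (suc k) ≡ x →
                IsCycle σ (x ∷ xs) → length (x ∷ xs) ≤ suc k
cycle-length≤ σ {x} {xs} k return (x∉xs ∷ _ , eq) =
  s≤s (≮⇒≥ λ k< → lookup x∉xs (iterate∈cycle _ x xs k eq k<) (sym return))

-- With the shift by four as `h`, this carries return times from `σ` over to `prepend σ`.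
iterate-semiconj : ∀ {A B : Set} {f : A → A} {g : B → B} (h : A → B) →
                   (∀ a → g (h a) ≡ h (f a)) → ∀ a k → iterate g (h a) k ≡ h (iterate f a k)
iterate-semiconj h comm a 0 = refl
iterate-semiconj {f = f} {g} h comm a (suc k) =
  trans (cong (λ b → iterate g b k) (comm a)) (iterate-semiconj h comm (f a) k)

displacement : Permutation′ n → Fin n → ℕ
displacement σ y = gap y (σ ⟨$⟩ʳ y)

-- Cycle lengths are controlled by a return after 1 to 5 steps, which a finite search decides at
-- each vertex. The bound 3, imposed at every vertex, covers the leaves and the neighbours of any
-- root.
IsLocalAt : Permutation′ n → Fin n → Set
IsLocalAt σ y = σ ⟨$⟩ʳ y ≢ y × displacement σ y ≤ 3
              × ∃[ k ] iterate (σ ⟨$⟩ʳ_) y (suc (toℕ {5} k)) ≡ y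

-- The lower bound excludes adjacency, which means gap 1; the upper bound is the sixth power.
SpreadsEdge : Permutation′ n → Fin n → Fin n → Set
SpreadsEdge σ a b = 2 ≤ gap (σ ⟨$⟩ʳ a) (σ ⟨$⟩ʳ b) × gap (σ ⟨$⟩ʳ a) (σ ⟨$⟩ʳ b) ≤ 6

-- No root occurs here, so one permutation serves every root that it moves by at most 2.
IsLocal : Permutation′ n → Set
IsLocal σ = (∀ y → IsLocalAt σ y) × (∀ a b → suc (toℕ a) ≡ toℕ b → SpreadsEdge σ a b)

isLocal? : (σ : Permutation′ n) → Dec (IsLocal σ)
isLocal? σ =
  all? (λ y → ¬? (σ ⟨$⟩ʳ y ≟ y) ×-dec displacement σ y ≤? 3
              ×-dec any? λ k → iterate (σ ⟨$⟩ʳ_) y (suc (toℕ k)) ≟ y)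
  ×-dec
  all? (λ a → all? λ b → suc (toℕ a) ≟ⁿ toℕ b
              →-dec (2 ≤? gap (σ ⟨$⟩ʳ a) (σ ⟨$⟩ʳ b) ×-dec gap (σ ⟨$⟩ʳ a) (σ ⟨$⟩ʳ b) ≤? 6))

spreadsEdge-adjacent : ∀ (σ : Permutation′ n) → IsLocal σ →
                       ∀ a b → Graph.Adj (P n) a b → SpreadsEdge σ a b
spreadsEdge-adjacent σ (_ , spread) a b (inj₁ eq) = spread a b eq
spreadsEdge-adjacent σ (_ , spread) a b (inj₂ eq) =
  subst (λ d → 2 ≤ d × d ≤ 6) (∣-∣-comm (toℕ (σ ⟨$⟩ʳ b)) _) (spread b a eq)

local⇒well : ∀ (σ : Permutation′ n) x → IsLocal σ → displacement σ x ≤ 2 →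
             IsWellPath2Placement n x σ
local⇒well {n} σ x local root = record
  { fixedPointFree = proj₁ ∘ proj₁ local
  ; placement      = placement
  ; inSixthPower   = λ a b e → gap⇒Dist≤ _ _ (proj₂ (spreadsEdge-adjacent σ local a b e))
  ; distRoot       = gap⇒Dist≤ _ _ root
  ; distNeighbour  = λ y _ → dist≤3 y
  ; distLeaf       = λ y _ → dist≤3 y
  ; cycleLength    = cycleLength
  }
  where
  dist≤3 : ∀ y → Dist≤ (P n) y (σ ⟨$⟩ʳ y) 3
  dist≤3 y = gap⇒Dist≤ _ _ (proj₁ (proj₂ (proj₁ local y)))

  placement : Is2Placement (P n) σ
  placement a b e e′
    with s≤s () ← subst (2 ≤_) (gap-adjacent _ _ e′) (proj₁ (spreadsEdge-adjacent σ local a b e))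

  cycleLength : ∀ c → IsCycle σ c → length c ≤ 5
  cycleLength (y ∷ _) cyc with _ , _ , k , return ← proj₁ local y =
    ≤-trans (cycle-length≤ σ (toℕ k) return cyc) (s≤s (toℕ≤pred[n] k))

prepend : Permutation′ n → Permutation′ (4 + n)
prepend {n} σ = permutation to from to∘from from∘to
  where
  to : Fin (4 + n) → Fin (4 + n)
  to 0F = 1F
  to 1F = 3F
  to 2F = 0F
  to 3F = 2F
  to (suc (suc (suc (suc i)))) = suc (suc (suc (suc (σ ⟨$⟩ʳ i))))

  from : Fin (4 + n) → Fin (4 + n)
  from 0F = 2F
  from 1F = 0F
  from 2F = 3F
  from 3F = 1F
  from (suc (suc (suc (suc i)))) = suc (suc (suc (suc (σ ⟨$⟩ˡ i))))

  to∘from : ∀ i → to (from i) ≡ i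
  to∘from 0F = refl
  to∘from 1F = refl
  to∘from 2F = refl
  to∘from 3F = refl
  to∘from (suc (suc (suc (suc i)))) = cong (4 ↑ʳ_) (inverseʳ σ)

  from∘to : ∀ i → from (to i) ≡ i
  from∘to 0F = refl
  from∘to 1F = refl
  from∘to 2F = refl
  from∘to 3F = refl
  from∘to (suc (suc (suc (suc i)))) = cong (4 ↑ʳ_) (inverseˡ σ)

prepend-local : ∀ (σ : Permutation′ n) → IsLocal σ → IsLocal (prepend σ)
prepend-local σ (at , spread) = at′ , spread′
  where
  at′ : ∀ y → IsLocalAt (prepend σ) y
  -- `3F` stands for four steps, once around the new 4-cycle.
  at′ 0F = (λ ()) , s≤s z≤n , 3F , refl
  at′ 1F = (λ ()) , s≤s (s≤s z≤n) , 3F , refl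
  at′ 2F = (λ ()) , s≤s (s≤s z≤n) , 3F , refl
  at′ 3F = (λ ()) , s≤s z≤n , 3F , refl
  at′ (suc (suc (suc (suc y)))) with moved , near , k , return ← at y =
    moved ∘ ↑ʳ-injective 4 _ _ , near , k ,
    trans (iterate-semiconj (4 ↑ʳ_) (λ _ → refl) y (suc (toℕ k)))
          (cong (4 ↑ʳ_) return)

  spread′ : ∀ a b → suc (toℕ a) ≡ toℕ b → SpreadsEdge (prepend σ) a b
  spread′ 0F 1F refl = s≤s (s≤s z≤n) , s≤s (s≤s z≤n)
  spread′ 1F 2F refl = s≤s (s≤s z≤n) , s≤s (s≤s (s≤s z≤n))
  spread′ 2F 3F refl = s≤s (s≤s z≤n) , s≤s (s≤s z≤n)
  -- The images are 2 and 4 plus the image of `0F` under `σ`, so their gap computes to 2 plus the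
  -- displacement of `0F`, at most 5.
  spread′ 3F 4F refl = s≤s (s≤s z≤n) , ≤-trans (+-monoʳ-≤ 2 (proj₁ (proj₂ (at 0F)))) (m≤m+n 5 1)
  spread′ (suc (suc (suc (suc a)))) (suc (suc (suc (suc b)))) eq = spread a b (cong (_∸ 4) eq)

AreInverse : Vec (Fin n) n → Vec (Fin n) n → Set
AreInverse σ τ = ∀ i → σ ‼ (τ ‼ i) ≡ i

areInverse? : ∀ (σ τ : Vec (Fin n) n) → Dec (AreInverse σ τ)
areInverse? σ τ = all? λ i → σ ‼ (τ ‼ i) ≟ i

fromTables : ∀ (σ τ : Vec (Fin n) n) {_ : True (areInverse? σ τ)} {_ : True (areInverse? τ σ)} →
             Permutation′ n
fromTables σ τ {στ} {τσ} = permutation (σ ‼_) (τ ‼_) (toWitness στ) (toWitness τσ)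

LocalWithRoot : Fin n → Set
LocalWithRoot {n} x = ∃[ σ ] IsLocal {n} σ × displacement σ x ≤ 2

-- Inversion reverses the cycles and redistributes the displacements among the vertices, so it can
-- help at a root that `σ` moves by 3. How edges spread is not inherited by the inverse, hence the
-- separate check.
localOrFlip : ∀ (σ : Permutation′ n) {_ : True (isLocal? σ)} {_ : True (isLocal? (flip σ))}
              {_ : True (all? λ x → displacement σ x ≤? 2 ⊎-dec displacement (flip σ) x ≤? 2)} →
              ∀ x → LocalWithRoot x
localOrFlip σ {local} {local⁻¹} {near} x with toWitness near x
... | inj₁ root = σ , toWitness local , root
... | inj₂ root = flip σ , toWitness local⁻¹ , root

localWithRoot : ∀ m (x : Fin (4 + m)) → LocalWithRoot x
localWithRoot 0 = localOrFlip (fromTables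
  (1F ∷ 3F ∷ 0F ∷ 2F ∷ [])
  (2F ∷ 0F ∷ 3F ∷ 1F ∷ []))
localWithRoot 1 = localOrFlip (fromTables
  (1F ∷ 3F ∷ 0F ∷ 4F ∷ 2F ∷ [])
  (2F ∷ 0F ∷ 4F ∷ 1F ∷ 3F ∷ []))
-- The cycles are (0 1 3)(2 5 4) here and (0 1 3)(2 5 6 4) for seven vertices. Both permutations
-- move vertices 2 and 3 by 3, and their inverses move these by 2.
localWithRoot 2 = localOrFlip (fromTables
  (1F ∷ 3F ∷ 5F ∷ 0F ∷ 2F ∷ 4F ∷ [])
  (3F ∷ 0F ∷ 4F ∷ 1F ∷ 5F ∷ 2F ∷ []))
localWithRoot 3 = localOrFlip (fromTables
  (1F ∷ 3F ∷ 5F ∷ 0F ∷ 2F ∷ 6F ∷ 4F ∷ [])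
  (3F ∷ 0F ∷ 4F ∷ 1F ∷ 6F ∷ 2F ∷ 5F ∷ []))
localWithRoot (suc (suc (suc (suc m)))) = extend
  where
  extendAt : ∀ y x → displacement (prepend (proj₁ (localWithRoot m y))) x ≤ 2 → LocalWithRoot x
  extendAt y x root = let σ , local , _ = localWithRoot m y in
    prepend σ , prepend-local σ local , root

  extend : ∀ x → LocalWithRoot x
  -- A root among the new vertices is moved by 1 or 2 by the new cycle, so the remaining path may
  -- take any root; `0F` is an arbitrary choice.
  extend 0F = extendAt 0F 0F (s≤s z≤n)
  extend 1F = extendAt 0F 1F (s≤s (s≤s z≤n))
  extend 2F = extendAt 0F 2F (s≤s (s≤s z≤n))
  extend 3F = extendAt 0F 3F (s≤s z≤n)
  -- Displacement is unchanged by the shift, so the bound at `y` is the bound at `x`.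
  extend x@(suc (suc (suc (suc y)))) = extendAt y x (proj₂ (proj₂ (localWithRoot m y)))

theorem3p1 : ∀ (n : ℕ) → 4 ≤ n → (x : Fin n) → ∃[ σ ] IsWellPath2Placement n x σ
theorem3p1 _ (s≤s (s≤s (s≤s (s≤s {n = m} _)))) x with σ , local , root ← localWithRoot m x =
  σ , local⇒well σ x local root
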